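{- Let $\dagger : \mathbb{G}(P)\times \mathcal{L}_0(P) \rightarrow \mathbb{G}(P)$ be a relevant P-graph transformation. Suppose that for every P-graph $G = \langle \Phi, \prec\rangle$ and every propositional formula $\varphi \in \mathcal{L}_0(P)$, the P-graph $\dagger(G,\varphi)= \langle \Phi_\dagger, \prec_\dagger\rangle$ satisfies both of the following conditions. 1. For all $\xi \in \Phi$ there is some $\xi' \in \Phi_\dagger$ such that (a) $\neg\varphi \wedge \xi \equiv \neg\varphi \wedge \xi'$, and (b) for all $\psi \in \Phi$, if $\psi \prec \xi$ then there is $\psi' \in \Phi_\dagger$ such that $\neg\varphi \wedge \psi \equiv \neg\varphi \wedge \psi'$ and $\psi'\prec_\dagger \xi'$. 2. For all $\xi \in \Phi_\dagger$, either $\xi \equiv \varphi$, or there is some $\xi' \in \Phi$ such that (a) $\neg\varphi \wedge \xi \equiv \neg\varphi \wedge \xi'$, and (b) for all $\psi \in \Phi_\dagger$, if $\psi \prec_\dagger \xi$ then either $\psi\equiv \varphi$, or there is $\psi' \in \Phi$ such that $\neg\varphi \wedge \psi \equiv \neg\varphi \wedge \psi'$ and $\psi'\prec \xi'$. Then $\dagger$ satisfies DP-2; that is, for every dynamic operator $\star$ induced by $\dagger$, every preference model $M=\langle W,\leq,v\rangle$ that is induced by some P-graph, every $\varphi\in\mathcal{L}_0(P)$, writing $\star(M,\varphi)=\langle W,\leq_{\star\varphi},v\rangle$, and all $w,w'\in W$: if $w\not\vDash\varphi$ and $w'\not\vDash\varphi$, then $w\leq_{\star\varphi} w'$ if and only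 if $w\leq w'$.
   Context: $P$ is a countable set of propositional symbols and $\mathcal{L}_0(P)$ is the set of classical propositional formulas over $P$; $\equiv$ is classical logical equivalence. P-graph: a pair $G=\langle\Phi,\prec\rangle$ with $\Phi\subseteq\mathcal{L}_0(P)$ and $\prec$ a strict partial order on $\Phi$. $\mathbb{G}(P)$ is the set of all P-graphs over $P$. Given a non-empty set $W$ of worlds and a valuation $v:P\to 2^W$, $w\vDash\varphi$ denotes classical satisfaction of $\varphi$ at $w$ (with $w\vDash p$ iff $w\in v(p)$). The relation $\leq_G$ on $W$ is: $w\leq_G w'$ iff for every $\varphi\in\Phi$, either ($w'\vDash\varphi$ implies $w\vDash\varphi$), or there is $\psi\in\Phi$ with $\psi\prec\varphi$, $w\vDash\psi$ and $w'\not\vDash\psi$. Preference model: $M=\langle W,\leq,v\rangle$ with $W$ a non-empty set, $v:P\to 2^W$, and $\leq$ a reflexive transitive relation on $W$ whose strict part $<$ ($w<w'$ iff $w\leq w'$ and not $w'\leq w$) is well-founded. $M$ is induced by a P-graph $G$ iff $\leq\;=\;\leq_G$ (computed with $W$ and $v$). Dynamic operator: a function $\star$ mapping each pair (preference model $\langle W,\leq,v\rangle$, formula $\varphi\in\mathcal{L}_0(P)$) to a preference model $\langle W,\leq_{\star\varphi},v\rangle$ with the same $W$ and $v$. P-graph transformation: any function $\dagger:\mathbb{G}(P)\times\mathcal{L}_0(P)\to\mathbb{G}(P)$. A dynamic operator $\star$ is induced by $\dagger$ if for all preference models $M$, P-graphs $G$ and formulas $\varphi\in\mathcal{L}_0(P)$: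 if $M$ is induced by $G$ then $\star(M,\varphi)$ is induced by $\dagger(G,\varphi)$. $\dagger$ is relevant if some dynamic operator is induced by it. -}

module Defs where

open import Data.Bool using (Bool; true; false; not; _∧_; _∨_; T)
open import Data.Nat using (ℕ)
open import Data.Product using (Σ; ∃-syntax; _×_; proj₁; proj₂)
open import Data.Sum using (_⊎_)
open import Function.Bundles using (_⇔_; _↣_)
open import Induction.WellFounded using (WellFounded)
open import Level using (0ℓ)
open import Relation.Binary.Core using (Rel)
open import Relation.Binary.Definitions using (Irreflexive; Transitive)
open import Relation.Binary.PropositionalEquality using (_≡_)
open import Relation.Binary.Structures using (IsPreorder)
open import Relation.Nullary using (¬_)
open import Relation.Unary using (Pred; _∈_)

-- Finite or countably infinite.
Countable : Set → Set
Countable A = A ↣ ℕ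

data Formula (P : Set) : Set where
  var             : P → Formula P
  ⊤′ ⊥′           : Formula P
  ¬′_             : Formula P → Formula P
  _∧′_ _∨′_ _⇒′_  : Formula P → Formula P → Formula P

infix  9 ¬′_
infixr 7 _∧′_
infixr 6 _∨′_
infixr 5 _⇒′_

record PGraph (P : Set) : Set₁ where
  infix 4 _≺_
  field
    Φ         : Pred (Formula P) 0ℓ
    _≺_       : Rel (Formula P) 0ℓ
    -- ≺ is a relation on Φ, that is, a subset of Φ × Φ.
    ≺-support : ∀ {ψ ξ} → ψ ≺ ξ → (ψ ∈ Φ) × (ξ ∈ Φ)
    ≺-irrefl  : Irreflexive _≡_ _≺_
    ≺-trans   : Transitive _≺_

Strict : {W : Set} → Rel W 0ℓ → Rel W 0ℓ
Strict _≤_ w w′ = (w ≤ w′) × ¬ (w′ ≤ w)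

record IsPreference {W : Set} (_≤_ : Rel W 0ℓ) : Set where
  field
    isPreorder  : IsPreorder _≡_ _≤_
    wellFounded : WellFounded (Strict _≤_)

-- A subset of W (an element of 2^W) is given by its characteristic function.
Valuation : Set → Set → Set
Valuation P W = P → W → Bool

record PreferenceModel (P : Set) : Set₁ where
  infix 4 _≤_
  field
    W            : Set
    nonEmpty     : W
    _≤_          : Rel W 0ℓ
    v            : Valuation P W
    isPreference : IsPreference _≤_

module _ {P : Set} where

  eval : (P → Bool) → Formula P → Bool
  eval a (var p)  = a p
  eval a ⊤′       = true
  eval a ⊥′       = false
  eval a (¬′ φ)   = not (eval a φ)
  eval a (φ ∧′ ψ) = eval a φ ∧ eval a ψ
  eval a (φ ∨′ ψ) = eval a φ ∨ eval a ψ
  eval a (φ ⇒′ ψ) = not (eval a φ) ∨ eval a ψ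

  infix 4 _≋_
  _≋_ : Rel (Formula P) 0ℓ
  φ ≋ ψ = ∀ a → eval a φ ≡ eval a ψ

  infix 4 _,_⊨_
  _,_⊨_ : {W : Set} → Valuation P W → W → Formula P → Set
  v , w ⊨ φ = T (eval (λ p → v p w) φ)

  GraphOrder : {W : Set} → Valuation P W → PGraph P → Rel W 0ℓ
  GraphOrder v G w w′ =
    ∀ φ → φ ∈ Φ →
      (v , w′ ⊨ φ → v , w ⊨ φ)
      ⊎ (∃[ ψ ] ψ ∈ Φ × ψ ≺ φ × (v , w ⊨ ψ) × ¬ (v , w′ ⊨ ψ))
    where open PGraph G

  InducedBy : PreferenceModel P → PGraph P → Set
  InducedBy M G = ∀ w w′ → w ≤ w′ ⇔ GraphOrder v G w w′
    where open PreferenceModel M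

  -- The new model has the same worlds and valuation by construction, so an
  -- operator only has to return the new preference relation.
  DynamicOperator : Set₁
  DynamicOperator =
    (M : PreferenceModel P) → Formula P →
    Σ (Rel (PreferenceModel.W M) 0ℓ) IsPreference

  apply : DynamicOperator → PreferenceModel P → Formula P → PreferenceModel P
  apply ⋆ M φ = record
    { W            = W
    ; nonEmpty     = nonEmpty
    ; _≤_          = proj₁ (⋆ M φ)
    ; v            = v
    ; isPreference = proj₂ (⋆ M φ)
    }
    where open PreferenceModel M

  Transformation : Set₁
  Transformation = PGraph P → Formula P → PGraph P

  OperatorInducedBy : DynamicOperator → Transformation → Set₁
  OperatorInducedBy ⋆ † =
    ∀ M G φ → InducedBy M G → InducedBy (apply ⋆ M φ) († G φ)

  Relevant : Transformation → Set₁
  Relevant † = ∃[ ⋆ ] OperatorInducedBy ⋆ †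

  Condition₁ : PGraph P → Formula P → PGraph P → Set
  Condition₁ G φ G† =
    ∀ ξ → ξ ∈ Φ →
      ∃[ ξ′ ] ξ′ ∈ Φ†
        × (¬′ φ ∧′ ξ ≋ ¬′ φ ∧′ ξ′)
        × (∀ ψ → ψ ∈ Φ → ψ ≺ ξ →
             ∃[ ψ′ ] ψ′ ∈ Φ† × (¬′ φ ∧′ ψ ≋ ¬′ φ ∧′ ψ′) × ψ′ ≺† ξ′)
    where
    open PGraph G
    open PGraph G† using () renaming (Φ to Φ†; _≺_ to _≺†_)

  Condition₂ : PGraph P → Formula P → PGraph P → Set
  Condition₂ G φ G† =
    ∀ ξ → ξ ∈ Φ† →
      (ξ ≋ φ)
      ⊎ (∃[ ξ′ ] ξ′ ∈ Φ
           × (¬′ φ ∧′ ξ ≋ ¬′ φ ∧′ ξ′)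
           × (∀ ψ → ψ ∈ Φ† → ψ ≺† ξ →
                (ψ ≋ φ)
                ⊎ (∃[ ψ′ ] ψ′ ∈ Φ × (¬′ φ ∧′ ψ ≋ ¬′ φ ∧′ ψ′) × ψ′ ≺ ξ′)))
    where
    open PGraph G
    open PGraph G† using () renaming (Φ to Φ†; _≺_ to _≺†_)

  DP-2 : Transformation → Set₁
  DP-2 † =
    (⋆ : DynamicOperator) → OperatorInducedBy ⋆ † →
    (M : PreferenceModel P) → (∃[ G ] InducedBy M G) →
    (φ : Formula P) →
    let open PreferenceModel M
        open PreferenceModel (apply ⋆ M φ) using () renaming (_≤_ to _≤⋆_)
    in
    (w w′ : W) → ¬ (v , w ⊨ φ) → ¬ (v , w′ ⊨ φ) → (w ≤⋆ w′) ⇔ (w ≤ w′)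

{-# OPTIONS --safe #-}

-- Clause (b) of the two conditions does not by itself transfer the order
-- between G and †(G, φ): it lets ξ′ have more predecessors than ξ. The order
-- does transfer when ≺ is empty, and everything reduces to that case. Given two
-- worlds w and w′, restrict the model to them. On two worlds the preorder of
-- any P-graph is also induced by a P-graph H with empty ≺, whose formulas are
-- those that are monotone for the preorder. Since the operator is a function
-- of the model, †(G, φ) and †(H, φ) induce the same order on the two worlds,
-- and †(H, φ) agrees with H on worlds falsifying φ.
module Submission where

open import Axiom.ExcludedMiddle using (ExcludedMiddle)
open import Data.Bool using (Bool; true; false; not; _∧_; T; T?)
open import Data.Bool.Properties using (¬-not)
open import Data.Empty using (⊥)
open import Data.Product using (_×_; _,_; proj₁; proj₂)
open import Data.Sum using (inj₁; inj₂)
open import Function.Base using (_on_)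
open import Function.Bundles using (_⇔_; mk⇔; module Equivalence)
open import Function.Properties.Equivalence using (⇔-setoid)
open import Level using (0ℓ)
import Relation.Binary.Construct.On as On
open import Relation.Binary.Core using (Rel)
open import Relation.Binary.PropositionalEquality
  using (_≡_; _≢_; refl; sym; trans; subst; isEquivalence)
open import Relation.Binary.Structures using (IsPreorder)
open import Relation.Nullary using (¬_; yes; no; contradiction)
open import Relation.Unary using (Pred; _∈_)
open import Defs

open Equivalence using (from)

T-∧-cancelˡ : ∀ b {x y} → ¬ T b → not b ∧ x ≡ not b ∧ y → T x → T y
T-∧-cancelˡ true  ¬b _  _ = contradiction _ ¬b
T-∧-cancelˡ false _  eq x = subst T eq x

≢-≢⇒≡ : {x y z : Bool} → x ≢ z → y ≢ z → x ≡ y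
≢-≢⇒≡ x≢z y≢z = trans (¬-not x≢z) (sym (¬-not y≢z))

module _ {P W : Set} (v : Valuation P W) (φ : Formula P) {w : W} (w⊭φ : ¬ (v , w ⊨ φ)) where

  ≋-falsified : ∀ {ξ} → ξ ≋ φ → ¬ (v , w ⊨ ξ)
  ≋-falsified ξ≋φ w⊨ξ = w⊭φ (subst T (ξ≋φ _) w⊨ξ)

  ⊨-transfer : ∀ {ξ ξ′} → ¬′ φ ∧′ ξ ≋ ¬′ φ ∧′ ξ′ → v , w ⊨ ξ → v , w ⊨ ξ′
  ⊨-transfer ξ≋ξ′ = T-∧-cancelˡ (eval _ φ) w⊭φ (ξ≋ξ′ _)

  ⊨-transfer⁻ : ∀ {ξ ξ′} → ¬′ φ ∧′ ξ ≋ ¬′ φ ∧′ ξ′ → v , w ⊨ ξ′ → v , w ⊨ ξ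
  ⊨-transfer⁻ ξ≋ξ′ = T-∧-cancelˡ (eval _ φ) w⊭φ (sym (ξ≋ξ′ _))

discrete : {P : Set} → Pred (Formula P) 0ℓ → PGraph P
discrete Φ = record
  { Φ         = Φ
  ; _≺_       = λ _ _ → ⊥
  ; ≺-support = λ ()
  ; ≺-irrefl  = λ _ ()
  ; ≺-trans   = λ ()
  }

module _ {P W : Set} (v : Valuation P W) (Φ : Pred (Formula P) 0ℓ)
         (φ : Formula P) (G† : PGraph P)
         (c₁ : Condition₁ (discrete Φ) φ G†) (c₂ : Condition₂ (discrete Φ) φ G†)
         {w w′ : W} (w⊭φ : ¬ (v , w ⊨ φ)) (w′⊭φ : ¬ (v , w′ ⊨ φ)) where

  -- Since `≺` is empty in `discrete Φ`, `c₂` lets only formulas equivalent to `φ` lie below a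
  -- formula of `G†` that is not itself equivalent to `φ`. Being false at `w`, these cannot witness
  -- the second alternative of `GraphOrder`.
  discrete-preserved : GraphOrder v G† w w′ ⇔ GraphOrder v (discrete Φ) w w′
  discrete-preserved = mk⇔ forth back
    where
    forth : GraphOrder v G† w w′ → GraphOrder v (discrete Φ) w w′
    forth w≤†w′ ξ ξ∈Φ with c₁ ξ ξ∈Φ
    ... | ξ′ , ξ′∈Φ† , ξ≋ξ′ , _ with w≤†w′ ξ′ ξ′∈Φ†
    ...   | inj₁ mono = inj₁ λ w′⊨ξ →
            ⊨-transfer⁻ v φ w⊭φ {ξ} {ξ′} ξ≋ξ′ (mono (⊨-transfer v φ w′⊭φ {ξ} {ξ′} ξ≋ξ′ w′⊨ξ))
    ...   | inj₂ (ψ , ψ∈Φ† , ψ≺†ξ′ , w⊨ψ , _) with c₂ ξ′ ξ′∈Φ†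
    -- Here `c₂` says nothing about predecessors of `ξ′`, but `ξ` agrees with `φ` at `w′`, so the
    -- implication is vacuous.
    ...     | inj₁ ξ′≋φ = inj₁ λ w′⊨ξ →
              contradiction (⊨-transfer v φ w′⊭φ {ξ} {ξ′} ξ≋ξ′ w′⊨ξ)
                            (≋-falsified v φ w′⊭φ {ξ′} ξ′≋φ)
    ...     | inj₂ (_ , _ , _ , preds) with preds ψ ψ∈Φ† ψ≺†ξ′
    ...       | inj₁ ψ≋φ = contradiction w⊨ψ (≋-falsified v φ w⊭φ {ψ} ψ≋φ)

    back : GraphOrder v (discrete Φ) w w′ → GraphOrder v G† w w′
    back w≤w′ ξ ξ∈Φ† with c₂ ξ ξ∈Φ†
    ... | inj₁ ξ≋φ = inj₁ λ w′⊨ξ → contradiction w′⊨ξ (≋-falsified v φ w′⊭φ {ξ} ξ≋φ)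
    ... | inj₂ (ξ′ , ξ′∈Φ , ξ≋ξ′ , _) with w≤w′ ξ′ ξ′∈Φ
    ...   | inj₁ mono = inj₁ λ w′⊨ξ →
            ⊨-transfer⁻ v φ w⊭φ {ξ} {ξ′} ξ≋ξ′ (mono (⊨-transfer v φ w′⊭φ {ξ} {ξ′} ξ≋ξ′ w′⊨ξ))

module _ {P : Set} (M : PreferenceModel P) {W′ : Set} (f : W′ → PreferenceModel.W M) where

  open PreferenceModel M
  open IsPreference isPreference

  -- A map `f` that need not be injective covers the case of two equal worlds without a case split.
  pullback : W′ → PreferenceModel P
  pullback w₀ = record
    { W            = W′
    ; nonEmpty     = w₀
    ; _≤_          = _≤_ on f
    ; v            = λ p w → v p (f w)
    ; isPreference = record
      { isPreorder  = record
        { isEquivalence = isEquivalence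
        ; reflexive     = λ { refl → IsPreorder.refl isPreorder }
        ; trans         = IsPreorder.trans isPreorder
        }
      ; wellFounded = On.wellFounded f wellFounded
      }
    }

  -- `GraphOrder` at two worlds depends only on the valuation there.
  pullback-induced : ∀ w₀ {G} → InducedBy M G → InducedBy (pullback w₀) G
  pullback-induced _ ind w w′ = ind (f w) (f w′)

-- The largest `Φ` for which `discrete Φ` induces an order containing `_≤_`.
Monotone : {P W : Set} → Valuation P W → Rel W 0ℓ → Pred (Formula P) 0ℓ
Monotone v _≤_ ξ = ∀ w w′ → w ≤ w′ → v , w′ ⊨ ξ → v , w ⊨ ξ

module _ {P : Set} (v : Valuation P Bool) (_≤_ : Rel Bool 0ℓ) where

  -- With only two worlds, a violation at `k ≤ l` forces `k` to be `i` and `l` to be `j`.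
  separating⇒monotone : ∀ {i j} ξ → ¬ (i ≤ j) → v , j ⊨ ξ → ¬ (v , i ⊨ ξ) → ξ ∈ Monotone v _≤_
  separating⇒monotone {i} {j} ξ i≰j j⊨ξ i⊭ξ k l k≤l l⊨ξ with T? (eval (λ p → v p k) ξ)
  ... | yes k⊨ξ = k⊨ξ
  ... | no  k⊭ξ with refl ← ≢-≢⇒≡ {k} {i} {j} (λ { refl → k⊭ξ j⊨ξ }) (λ { refl → i⊭ξ j⊨ξ })
                   | refl ← ≢-≢⇒≡ {l} {j} {i} (λ { refl → i⊭ξ l⊨ξ }) (λ { refl → i⊭ξ j⊨ξ })
                   = contradiction k≤l i≰j

  two-worlds-discrete : ExcludedMiddle 0ℓ → (G : PGraph P) →
    (∀ i j → i ≤ j ⇔ GraphOrder v G i j) →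
    ∀ i j → i ≤ j ⇔ GraphOrder v (discrete (Monotone v _≤_)) i j
  two-worlds-discrete em G ind i j = mk⇔ (λ i≤j ξ mono → inj₁ (mono i j i≤j)) back
    where
    back : GraphOrder v (discrete (Monotone v _≤_)) i j → i ≤ j
    back i≤ᴴj with em {i ≤ j}
    ... | yes i≤j = i≤j
    -- A formula true at `j` and false at `i` would now be monotone, which `i≤ᴴj` rules out. So the
    -- first alternative holds for every formula of `G`, whatever its `≺`.
    ... | no  i≰j = from (ind i j) λ ξ _ → inj₁ (mono ξ)
      where
      mono : ∀ ξ → v , j ⊨ ξ → v , i ⊨ ξ
      mono ξ j⊨ξ with T? (eval (λ p → v p i) ξ)
      ... | yes i⊨ξ = i⊨ξ
      ... | no  i⊭ξ with inj₁ m ← i≤ᴴj ξ (separating⇒monotone ξ i≰j j⊨ξ i⊭ξ) = m j⊨ξ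

proposition12 : ExcludedMiddle 0ℓ →
    (P : Set) → Countable P →
    († : Transformation {P}) → Relevant † →
    (∀ G φ → Condition₁ G φ († G φ) × Condition₂ G φ († G φ)) →
    DP-2 †
proposition12 em P _ † _ cond ⋆ ⋆-ind M (G , M-ind) φ w w′ w⊭φ w′⊭φ =
  begin
    proj₁ (⋆ M φ) w w′            ≈⟨ ⋆-ind M G φ M-ind w w′ ⟩
    -- This is definitionally the order of `† G φ` on `M₂` at `false` and `true`.
    GraphOrder v († G φ) w w′     ≈⟨ ⋆-ind M₂ G φ M₂-ind false true ⟨
    proj₁ (⋆ M₂ φ) false true     ≈⟨ ⋆-ind M₂ H φ M₂-ind-H false true ⟩
    GraphOrder v₂ († H φ) false true
      ≈⟨ discrete-preserved v₂ _ φ († H φ) (proj₁ (cond H φ)) (proj₂ (cond H φ)) w⊭φ w′⊭φ ⟩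
    GraphOrder v₂ H false true    ≈⟨ M₂-ind-H false true ⟨
    w ≤ w′                        ∎
  where
  open PreferenceModel M using (W; _≤_; v)
  open import Relation.Binary.Reasoning.Setoid (⇔-setoid 0ℓ)

  pair : Bool → W
  pair false = w
  pair true  = w′

  M₂ : PreferenceModel P
  M₂ = pullback M pair false

  open PreferenceModel M₂ using () renaming (v to v₂; _≤_ to _≤₂_)

  M₂-ind : InducedBy M₂ G
  M₂-ind = pullback-induced M pair false {G} M-ind

  H : PGraph P
  H = discrete (Monotone v₂ _≤₂_)

  M₂-ind-H : InducedBy M₂ H
  M₂-ind-H = two-worlds-discrete v₂ _≤₂_ em G M₂-ind
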